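{- Let $\Delta$ and $\Delta'$ be finite thick generalized quadrangles, and let $\phi:\Delta\to\Delta'$ be a morphism which surjectively maps a geometrical hyperplane $\mathcal{G}$ of $\Delta$ to a geometrical hyperplane $\mathcal{G}'$ of $\Delta'$, i.e. $\phi(\mathcal{G})=\mathcal{G}'$. If $\mathcal{G}'$ is not of type B, then $\phi$ is surjective.
   Context: A point-line geometry is a weak generalized $4$-gon if any two elements (points or lines) lie in a common ordinary sub $4$-gon and there are no ordinary sub $k$-gons for $k=2,3$; it is a (thick) generalized quadrangle if moreover every point is on at least three lines and every line has at least three points. Order $(s,t)$ means that each line has $s+1$ points and each point is on $t+1$ lines. A morphism maps points to points, lines to lines, and preserves incidence. A geometrical hyperplane of a finite thick generalized quadrangle $\mathcal{S}$ of order $(s,t)$ is a subgeometry $\mathcal{S}'$ such that each line $U$ of $\mathcal{S}$ either contains exactly one point of $\mathcal{S}'$, and then $U$ is not a line of $\mathcal{S}'$, or has all its points in $\mathcal{S}'$, and then $U$ is a line of $\mathcal{S}'$. There are only three types: type A, $\mathcal{S}'$ is an ovoid of $\mathcal{S}$ (and has no lines); type B, $\mathcal{S}'$ is the point-line geometry of a set $x^{\perp}$ (the points collinear with or equal to $x$), with $x$ a point of $\mathcal{S}$, so that the lines of $\mathcal{S}'$ are exactly the lines of $\mathcal{S}$ incident with $x$; type C, $\mathcal{S}'$ is a (possibly thin) subquadrangle of order $(s,t/s)$. -}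

module Defs where

open import Data.Fin using (Fin; toℕ)
open import Data.Nat using (ℕ; suc; NonZero)
open import Data.Nat.DivMod using (_%_)
open import Data.Product using (Σ; ∃; ∃!; ∃-syntax; _×_)
open import Data.Sum using (_⊎_; inj₁; inj₂)
open import Function.Bundles using (_↔_; _⇔_)
open import Function.Definitions using (Injective; Surjective)
open import Level using (0ℓ)
open import Relation.Binary.Core using (REL)
open import Relation.Binary.Definitions using (Decidable)
open import Relation.Binary.PropositionalEquality using (_≡_)
open import Relation.Nullary using (¬_)
open import Relation.Unary using (Pred; _∈_; _∉_)
import Relation.Unary as U

record Geometry : Set₁ where
  field
    Point : Set
    Line  : Set
    _I_   : REL Point Line 0ℓ

  Element : Set
  Element = Point ⊎ Line

  Collinear : Point → Point → Set
  Collinear p q = ∃[ L ] (p I L × q I L)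

  _^⊥ : Point → Pred Point 0ℓ
  (x ^⊥) p = p ≡ x ⊎ Collinear p x

open Geometry public using (Point; Line; Element)

-- Decidability of incidence is automatic classically.
record IsFinite (Δ : Geometry) : Set where
  open Geometry Δ using (_I_)
  field
    #points : ℕ
    #lines  : ℕ
    points  : Point Δ ↔ Fin #points
    lines   : Line Δ ↔ Fin #lines
    _I?_    : Decidable _I_

-- The sides and vertices of an ordinary k-gon are numbered cyclically so that
-- side j joins the vertices j and j + 1 (mod k).
VertexOnSide : (k : ℕ) .{{_ : NonZero k}} → Fin k → Fin k → Set
VertexOnSide k i j = toℕ i ≡ toℕ j ⊎ toℕ i ≡ suc (toℕ j) % k

record OrdinarySubgon (Δ : Geometry) (k : ℕ) .{{_ : NonZero k}} : Set where
  open Geometry Δ using (_I_)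
  field
    vertex           : Fin k → Point Δ
    side             : Fin k → Line Δ
    vertex-injective : Injective _≡_ _≡_ vertex
    side-injective   : Injective _≡_ _≡_ side
    incidence        : ∀ i j → vertex i I side j ⇔ VertexOnSide k i j

  Contains : Pred (Element Δ) 0ℓ
  Contains (inj₁ p) = ∃[ i ] vertex i ≡ p
  Contains (inj₂ L) = ∃[ i ] side i ≡ L

record IsWeakGeneralizedQuadrangle (Δ : Geometry) : Set where
  open OrdinarySubgon using (Contains)
  field
    common-4-gon : (x y : Element Δ) →
                   Σ (OrdinarySubgon Δ 4) λ Γ → x ∈ Contains Γ × y ∈ Contains Γ
    no-2-gon     : ¬ OrdinarySubgon Δ 2
    no-3-gon     : ¬ OrdinarySubgon Δ 3

record IsThick (Δ : Geometry) : Set where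
  open Geometry Δ using (_I_)
  field
    three-lines  : (p : Point Δ) →
                   Σ (Fin 3 → Line Δ) λ L → Injective _≡_ _≡_ L × (∀ i → p I L i)
    three-points : (L : Line Δ) →
                   Σ (Fin 3 → Point Δ) λ p → Injective _≡_ _≡_ p × (∀ i → p i I L)

-- An order (s , t) is not part of the data: it exists for every non-empty
-- finite thick generalized quadrangle.
record IsFiniteThickGQ (Δ : Geometry) : Set where
  field
    isFinite                    : IsFinite Δ
    isWeakGeneralizedQuadrangle : IsWeakGeneralizedQuadrangle Δ
    isThick                     : IsThick Δ

-- A set of points and a set of lines, with the induced incidence.
-- Decidability is automatic classically.
record Subgeometry (Δ : Geometry) : Set₁ where
  field
    Points  : Pred (Point Δ) 0ℓ
    Lines   : Pred (Line Δ) 0ℓ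
    points? : U.Decidable Points
    lines?  : U.Decidable Lines

open Subgeometry public using (Points; Lines)

-- Hyperplanes are proper: the whole geometry satisfies `dichotomy`, but is
-- neither an ovoid, nor the geometry of some x^⊥, nor a subquadrangle of order
-- (s , t/s), because s ≥ 2.
record IsHyperplane (Δ : Geometry) (𝒢 : Subgeometry Δ) : Set where
  open Geometry Δ using (_I_)
  field
    proper    : ∃[ p ] p ∉ Points 𝒢
    dichotomy : (U : Line Δ) →
                (∃! _≡_ (λ p → p I U × p ∈ Points 𝒢) × U ∉ Lines 𝒢)
                ⊎ ((∀ p → p I U → p ∈ Points 𝒢) × U ∈ Lines 𝒢)

IsTypeB : (Δ : Geometry) → Subgeometry Δ → Set
IsTypeB Δ 𝒢 = ∃[ x ] ((∀ p → p ∈ Points 𝒢 ⇔ p ∈ x ^⊥) × (∀ L → L ∈ Lines 𝒢 ⇔ x I L))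
  where open Geometry Δ using (_I_; _^⊥)

record Morphism (Δ Δ′ : Geometry) : Set where
  open Geometry Δ using (_I_)
  open Geometry Δ′ using () renaming (_I_ to _I′_)
  field
    onPoints   : Point Δ → Point Δ′
    onLines    : Line Δ → Line Δ′
    preservesI : ∀ {p L} → p I L → onPoints p I′ onLines L

module _ {Δ Δ′ : Geometry} (φ : Morphism Δ Δ′) where
  open Morphism φ

  -- φ(𝒢) = 𝒢′
  ImageIs : Subgeometry Δ → Subgeometry Δ′ → Set
  ImageIs 𝒢 𝒢′ =
      (∀ p′ → p′ ∈ Points 𝒢′ ⇔ (∃[ p ] (p ∈ Points 𝒢 × onPoints p ≡ p′)))
    × (∀ L′ → L′ ∈ Lines 𝒢′ ⇔ (∃[ L ] (L ∈ Lines 𝒢 × onLines L ≡ L′)))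

  IsSurjective : Set
  IsSurjective = Surjective _≡_ _≡_ onPoints × Surjective _≡_ _≡_ onLines

{-# OPTIONS --safe #-}
-- If some line of Δ is mapped outside 𝒢′, the image spreads: when a line L′ of
-- the image meets 𝒢′ in one point and y′ is another point of L′, every further
-- line through y′ meets 𝒢′ = φ(𝒢) and is recovered by projecting a preimage
-- onto a line above L′.  As the complement of 𝒢′ is connected, the image is
-- everything.
--
-- Otherwise φ(Δ) lies in 𝒢′, and since 𝒢′ is not of type B each of its points is
-- on two of its lines.  Then φ is injective on points, which contradicts
-- φ(𝒢) = 𝒢′ with 𝒢 proper.  The crucial claim is that a point v is on at most one
-- line above a given line K′.  Following the lines through v above K′ along a
-- chain of perspectivities back to v gives an injective map of a finite set to
-- itself; it is therefore onto, and with the chain chosen suitably this fails if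
-- there are two such lines.
module Submission where

open import Defs
open import Data.Empty using (⊥)
open import Data.Fin using (Fin; punchOut)
open import Data.Fin.Properties
  using (_≟_; any?; all?; punchOut-injective; injective⇒≤)
open import Data.Fin.Patterns using (0F; 1F; 2F)
open import Data.Nat using (suc)
open import Data.Nat.Properties using (1+n≰n)
import Data.Nat.Properties as ℕ
open import Data.Product using (∃; ∃-syntax; _×_; _,_; proj₁; proj₂)
open import Data.Sum using (inj₁; inj₂; [_,_]′)
open import Function using (_∘_; _↔_; Injective; Inverse; mk⇔; Equivalence)
open import Function.Properties.Inverse using (↔⇒↣)
open import Level using (0ℓ)
open import Relation.Binary.Definitions using (DecidableEquality)
open import Relation.Binary.PropositionalEquality
  using (_≡_; _≢_; refl; sym; trans; cong; subst)
open import Relation.Nullary using (¬_; Dec; yes; no; contradiction)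
open import Relation.Nullary.Decidable
  using (_×-dec_; _⊎-dec_; ¬?; map′; from-yes; via-injection; decidable-stable)
open import Relation.Unary using (Pred; Decidable; _∈_; _∉_)

-- Finite types

-- If `a` and `b` were the only values, recording which one occurs would embed `Fin 3` in `Fin 2`.
avoid-two : ∀ {A : Set} → DecidableEquality A → {f : Fin 3 → A} →
            Injective _≡_ _≡_ f → ∀ a b → ∃[ i ] f i ≢ a × f i ≢ b
avoid-two _≟A_ {f} inj a b
  with any? (λ i → ¬? (f i ≟A a) ×-dec ¬? (f i ≟A b))
... | yes found = found
... | no none   = contradiction (injective⇒≤ code-injective) 1+n≰n
  where
  code : Fin 3 → Fin 2
  code i with f i ≟A a
  ... | yes _ = 0F
  ... | no _  = 1F

  code-injective : Injective _≡_ _≡_ code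
  code-injective {i} {j} eq with f i ≟A a | f j ≟A a
  ... | yes p | yes q = inj (trans p (sym q))
  ... | no p  | no q  = inj (trans (is-b i p) (sym (is-b j q)))
    where
    is-b : ∀ k → f k ≢ a → f k ≡ b
    is-b k k≢a = decidable-stable (f k ≟A b) (λ k≢b → none (k , k≢a , k≢b))

injective⇒surjective : ∀ {n} {f : Fin n → Fin n} →
                       Injective _≡_ _≡_ f → ∀ i → ∃[ k ] f k ≡ i
injective⇒surjective {suc n} {f} inj i with any? (λ k → f k ≟ i)
... | yes found = found
... | no none   = contradiction (injective⇒≤ g-injective) 1+n≰n
  where
  i≢f : ∀ k → i ≢ f k
  i≢f k eq = none (k , sym eq)

  g-injective : Injective _≡_ _≡_ (λ k → punchOut (i≢f k))
  g-injective {x} {y} eq = inj (punchOut-injective (i≢f x) (i≢f y) eq)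

module FiniteType {A : Set} {n} (A↔Fin : A ↔ Fin n) where
  open Inverse A↔Fin using (to; from; strictlyInverseˡ; strictlyInverseʳ)

  _≟′_ : DecidableEquality A
  _≟′_ = via-injection (↔⇒↣ A↔Fin) _≟_

  search : {P : Pred A 0ℓ} → Decidable P → Dec (∃ P)
  search {P} P? = map′ (λ (i , p) → from i , p)
                       (λ (a , p) → to a , subst P (sym (strictlyInverseʳ a)) p)
                       (any? (P? ∘ from))

  module _ {P : Pred A 0ℓ} (P? : Decidable P) (f : A → A)
           (closed : ∀ {a} → P a → P (f a))
           (inj : ∀ {a b} → P a → P b → f a ≡ f b → a ≡ b) where

    private
      -- Continuing `f` by the identity outside `P` gives a self-map of the whole type; `closed`
      -- keeps the two parts from colliding.
      extend : A → A
      extend a with P? a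
      ... | yes _ = f a
      ... | no _  = a

      extend-injective : Injective _≡_ _≡_ extend
      extend-injective {a} {b} eq with P? a | P? b
      ... | yes p | yes q = inj p q eq
      ... | yes p | no ¬q = contradiction (subst P eq (closed p)) ¬q
      ... | no ¬p | yes q = contradiction (subst P (sym eq) (closed q)) ¬p
      ... | no _  | no _  = eq

      from-injective : Injective _≡_ _≡_ from
      from-injective {i} {j} eq =
        trans (sym (strictlyInverseˡ i)) (trans (cong to eq) (strictlyInverseˡ j))

      to-injective : Injective _≡_ _≡_ to
      to-injective {a} {b} eq =
        trans (sym (strictlyInverseʳ a)) (trans (cong from eq) (strictlyInverseʳ b))

    injective-on⇒surjective-on : ∀ {b} → P b → ∃[ a ] P a × f a ≡ b
    injective-on⇒surjective-on {b} Pb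
      with injective⇒surjective {f = to ∘ extend ∘ from}
             (from-injective ∘ extend-injective ∘ to-injective) (to b)
    ... | k , eq = preimage (from k) (to-injective eq)
      where
      preimage : ∀ a → extend a ≡ b → ∃[ a ] P a × f a ≡ b
      preimage a eq with P? a
      ... | yes p = a , p , eq
      ... | no ¬p = contradiction (subst P (sym eq) Pb) ¬p

-- Generalized quadrangles

opaque
  -- Evaluation over the sixteen pairs confirms this. It supplies the existence half of projection
  -- onto a line.
  4-gon-path : ∀ i j → ∃[ k ] ∃[ m ]
    VertexOnSide 4 i k × VertexOnSide 4 m k × VertexOnSide 4 m j
  4-gon-path = from-yes (all? λ i → all? λ j → any? λ k → any? λ m →
                           on? i k ×-dec on? m k ×-dec on? m j)
    where
    on? : ∀ i j → Dec (VertexOnSide 4 i j)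
    on? i j = (_ ℕ.≟ _) ⊎-dec (_ ℕ.≟ _)

module GQ {Δ : Geometry} (isFiniteThickGQ : IsFiniteThickGQ Δ) where
  open Geometry Δ using (_I_)
  open IsFiniteThickGQ isFiniteThickGQ
  open IsFinite isFinite public using (_I?_)
  open IsWeakGeneralizedQuadrangle isWeakGeneralizedQuadrangle
  open IsThick isThick
  open IsFinite isFinite using (points; lines)
  open FiniteType points public using () renaming (_≟′_ to _≟P_)
  open FiniteType lines public
    using (injective-on⇒surjective-on)
    renaming (_≟′_ to _≟L_; search to searchLine)

  opaque
    third-point : ∀ L a b → ∃[ p ] p I L × p ≢ a × p ≢ b
    third-point L a b =
      let p , inj , on = three-points L
          i , ≢a , ≢b  = avoid-two _≟P_ inj a b
      in p i , on i , ≢a , ≢b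

    third-line : ∀ p A B → ∃[ L ] p I L × L ≢ A × L ≢ B
    third-line p A B =
      let L , inj , on = three-lines p
          i , ≢A , ≢B  = avoid-two _≟L_ inj A B
      in L i , on i , ≢A , ≢B

  second-point : ∀ L a → ∃[ p ] p I L × p ≢ a
  second-point L a = let p , on , ≢a , _ = third-point L a a in p , on , ≢a

  second-line : ∀ p A → ∃[ L ] p I L × L ≢ A
  second-line p A = let L , on , ≢A , _ = third-line p A A in L , on , ≢A

  line-through : ∀ p → ∃[ L ] p I L
  line-through p = let L , _ , on = three-lines p in L 0F , on 0F

  line-unique : ∀ {p q L M} → p ≢ q → p I L → q I L → p I M → q I M → L ≡ M
  line-unique {p} {q} {L} {M} p≢q pL qL pM qM =
    decidable-stable (L ≟L M) (λ L≢M → no-2-gon (2-gon L≢M))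
    where
    2-gon : L ≢ M → OrdinarySubgon Δ 2
    2-gon L≢M = record
      { vertex           = λ { 0F → p ; 1F → q }
      ; side             = λ { 0F → L ; 1F → M }
      ; vertex-injective = λ { {0F} {0F} _ → refl ; {1F} {1F} _ → refl
                             ; {0F} {1F} e → contradiction e p≢q
                             ; {1F} {0F} e → contradiction (sym e) p≢q }
      ; side-injective   = λ { {0F} {0F} _ → refl ; {1F} {1F} _ → refl
                             ; {0F} {1F} e → contradiction e L≢M
                             ; {1F} {0F} e → contradiction (sym e) L≢M }
      ; incidence        = λ { 0F 0F → mk⇔ (λ _ → inj₁ refl) (λ _ → pL)
                             ; 0F 1F → mk⇔ (λ _ → inj₂ refl) (λ _ → pM)
                             ; 1F 0F → mk⇔ (λ _ → inj₂ refl) (λ _ → qL)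
                             ; 1F 1F → mk⇔ (λ _ → inj₁ refl) (λ _ → qM) }
      }

  -- Otherwise `p`, `q`, `r` would be the vertices of an ordinary triangle. This is the uniqueness
  -- half of projection onto a line.
  foot-unique : ∀ {p q r A B C} → ¬ p I B → p I A → q I A → q I B →
                p I C → r I C → r I B → q ≡ r
  foot-unique {p} {q} {r} {A} {B} {C} p∉B pA qA qB pC rC rB =
    decidable-stable (q ≟P r) (λ q≢r → no-3-gon (3-gon q≢r))
    where
    3-gon : q ≢ r → OrdinarySubgon Δ 3
    3-gon q≢r = record
      { vertex           = λ { 0F → p ; 1F → q ; 2F → r }
      ; side             = λ { 0F → A ; 1F → B ; 2F → C }
      ; vertex-injective = λ { {0F} {0F} _ → refl ; {1F} {1F} _ → refl
                             ; {2F} {2F} _ → refl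
                             ; {0F} {1F} e → contradiction e p≢q
                             ; {1F} {0F} e → contradiction (sym e) p≢q
                             ; {0F} {2F} e → contradiction e p≢r
                             ; {2F} {0F} e → contradiction (sym e) p≢r
                             ; {1F} {2F} e → contradiction e q≢r
                             ; {2F} {1F} e → contradiction (sym e) q≢r }
      ; side-injective   = λ { {0F} {0F} _ → refl ; {1F} {1F} _ → refl
                             ; {2F} {2F} _ → refl
                             ; {0F} {1F} e → contradiction e A≢B
                             ; {1F} {0F} e → contradiction (sym e) A≢B
                             ; {0F} {2F} e → contradiction e A≢C
                             ; {2F} {0F} e → contradiction (sym e) A≢C
                             ; {1F} {2F} e → contradiction (sym e) C≢B
                             ; {2F} {1F} e → contradiction e C≢B }
      ; incidence        = λ { 0F 0F → mk⇔ (λ _ → inj₁ refl) (λ _ → pA)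
                             ; 0F 1F → mk⇔ (λ i → contradiction i p∉B)
                                           (λ { (inj₁ ()) ; (inj₂ ()) })
                             ; 0F 2F → mk⇔ (λ _ → inj₂ refl) (λ _ → pC)
                             ; 1F 0F → mk⇔ (λ _ → inj₂ refl) (λ _ → qA)
                             ; 1F 1F → mk⇔ (λ _ → inj₁ refl) (λ _ → qB)
                             ; 1F 2F → mk⇔ (λ i → contradiction i q∉C)
                                           (λ { (inj₁ ()) ; (inj₂ ()) })
                             ; 2F 0F → mk⇔ (λ i → contradiction i r∉A)
                                           (λ { (inj₁ ()) ; (inj₂ ()) })
                             ; 2F 1F → mk⇔ (λ _ → inj₂ refl) (λ _ → rB)
                             ; 2F 2F → mk⇔ (λ _ → inj₁ refl) (λ _ → rC) }
      }
      where
      p≢q : p ≢ q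
      p≢q refl = p∉B qB
      p≢r : p ≢ r
      p≢r refl = p∉B rB
      A≢B : A ≢ B
      A≢B refl = p∉B pA
      C≢B : C ≢ B
      C≢B refl = p∉B pC
      q∉C : ¬ q I C
      q∉C qC = C≢B (line-unique q≢r qC rC qB rB)
      r∉A : ¬ r I A
      r∉A rA = A≢B (line-unique q≢r qA rA qB rB)
      A≢C : A ≢ C
      A≢C refl = q∉C qA

  join-unique : ∀ {p q r A B C} → ¬ p I B → p I A → q I A → q I B →
                p I C → r I C → r I B → A ≡ C
  join-unique {p} {q} p∉B pA qA qB pC rC rB
    with refl ← foot-unique p∉B pA qA qB pC rC rB =
    line-unique (λ { refl → p∉B qB }) pA qA pC rC

  opaque
    project : ∀ p L → ∃[ M ] ∃[ q ] p I M × q I M × q I L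
    project p L with common-4-gon (inj₁ p) (inj₂ L)
    ... | Γ , (i , refl) , (j , refl) =
      let k , m , i∈k , m∈k , m∈j = 4-gon-path i j
      in side k , vertex m , on i∈k , on m∈k , on m∈j
      where
      open OrdinarySubgon Γ

      on : ∀ {i j} → VertexOnSide 4 i j → vertex i I side j
      on {i} {j} = Equivalence.from (incidence i j)

  -- When p is on L, the point foot p L and the line join p L are arbitrary
  -- choices satisfying the three incidences below.
  join : Point Δ → Line Δ → Line Δ
  join p L = proj₁ (project p L)

  foot : Point Δ → Line Δ → Point Δ
  foot p L = proj₁ (proj₂ (project p L))

  join-on : ∀ p L → p I join p L
  join-on p L = proj₁ (proj₂ (proj₂ (project p L)))

  foot-join : ∀ p L → foot p L I join p L
  foot-join p L = proj₁ (proj₂ (proj₂ (proj₂ (project p L))))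

  foot-on : ∀ p L → foot p L I L
  foot-on p L = proj₂ (proj₂ (proj₂ (proj₂ (project p L))))

  join-is : ∀ {p q L M} → ¬ p I L → p I M → q I M → q I L → join p L ≡ M
  join-is {p} {q} {L} {M} p∉L pM qM qL =
    join-unique p∉L (join-on p L) (foot-join p L) (foot-on p L) pM qM qL

  -- `M` itself leads from `p` to `join r M`, so joining back undoes a perspectivity. This is what
  -- makes chains of perspectivities injective.
  join-join : ∀ {p r M} → p I M → ¬ p I join r M → join p (join r M) ≡ M
  join-join {p} {r} {M} pM p∉N = join-is p∉N pM (foot-on r M) (foot-join r M)

-- Geometrical hyperplanes

module Hyperplane {Δ : Geometry} (gq : IsFiniteThickGQ Δ)
                  {𝒢 : Subgeometry Δ} (isHyperplane : IsHyperplane Δ 𝒢) where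
  open Geometry Δ using (_I_; _^⊥)
  open GQ gq
  open IsHyperplane isHyperplane
  open Subgeometry 𝒢 using (points?; lines?)

  full : ∀ {p L} → L ∈ Lines 𝒢 → p I L → p ∈ Points 𝒢
  full {p} {L} L∈ pL with dichotomy L
  ... | inj₁ (_ , L∉)    = contradiction L∈ L∉
  ... | inj₂ (all∈ , _) = all∈ p pL

  spanned : ∀ {p q L} → p ≢ q → p ∈ Points 𝒢 → q ∈ Points 𝒢 →
            p I L → q I L → L ∈ Lines 𝒢
  spanned {L = L} p≢q p∈ q∈ pL qL with dichotomy L
  ... | inj₁ ((_ , _ , uniq) , _) =
    contradiction (trans (sym (uniq (pL , p∈))) (uniq (qL , q∈))) p≢q
  ... | inj₂ (_ , L∈) = L∈

  meets : ∀ L → ∃[ p ] p I L × p ∈ Points 𝒢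
  meets L with dichotomy L
  ... | inj₁ ((p , on , _) , _) = p , on
  ... | inj₂ (all∈ , _) =
    let p , pL , _ = second-point L (proj₁ proper) in p , pL , all∈ p pL

  outside∉ : ∀ {p L} → p I L → p ∉ Points 𝒢 → L ∉ Lines 𝒢
  outside∉ pL p∉ L∈ = p∉ (full L∈ pL)

  outside-point : ∀ {L} → L ∉ Lines 𝒢 → ∀ q → ∃[ p ] p I L × p ≢ q × p ∉ Points 𝒢
  outside-point {L} L∉ q =
    let g , gL , g∈        = meets L
        p , pL , p≢q , p≢g = third-point L q g
    in p , pL , p≢q , λ p∈ → L∉ (spanned p≢g p∈ g∈ pL gL)

  join∈ : ∀ {p L} → p ∈ Points 𝒢 → L ∈ Lines 𝒢 → ¬ p I L → join p L ∈ Lines 𝒢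
  join∈ {p} {L} p∈ L∈ p∉L =
    spanned (λ eq → p∉L (subst (_I L) (sym eq) (foot-on p L)))
      p∈ (full L∈ (foot-on p L)) (join-on p L) (foot-join p L)

  -- Connectedness of the complement, phrased as propagation of `P` along lines. Two outside points
  -- `x`, `y` of `L` are projected onto a line `M` through `z`. As `M` has a single point in `𝒢`,
  -- feet both in `𝒢` would coincide and form a triangle with `x` and `y`.
  outside-connected : (P : Pred (Point Δ) 0ℓ) →
    (∀ {x y L} → x I L → y I L → x ∉ Points 𝒢 → y ∉ Points 𝒢 → P x → P y) →
    ∀ {x z} → x ∉ Points 𝒢 → z ∉ Points 𝒢 → P x → P z
  outside-connected P step {x} {z} x∉ z∉ Px
    with line-through x
  ... | L , xL with z I? L | outside-point (outside∉ xL x∉) x | meets L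
  ... | yes zL | _ | _ = step xL zL x∉ z∉ Px
  -- `M` is not the join of `z` to `L`, so it misses `L`.
  ... | no z∉L | y , yL , y≢x , y∉ | g , gL , g∈ with second-line z (join z L)
  ... | M , zM , M≢ with points? (foot x M) | points? (foot y M)
  ... | no f∉ | _ =
    step (foot-on x M) zM f∉ z∉ (step (join-on x M) (foot-join x M) x∉ f∉ Px)
  ... | yes _ | no f∉ =
    step (foot-on y M) zM f∉ z∉
      (step (join-on y M) (foot-join y M) y∉ f∉ (step xL yL x∉ y∉ Px))
  ... | yes h∈ | yes k∈ = contradiction (sym x≡y) y≢x
    where
    h≡k : foot x M ≡ foot y M
    h≡k = decidable-stable (_ ≟P _) λ h≢k →
      outside∉ zM z∉ (spanned h≢k h∈ k∈ (foot-on x M) (foot-on y M))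

    h∉L : ¬ foot x M I L
    h∉L hL = M≢ (sym (join-is z∉L zM (foot-on x M) hL))

    x≡y : x ≡ y
    x≡y = foot-unique h∉L (foot-join x M) (join-on x M) xL
            (subst (_I join y M) (sym h≡k) (foot-join y M)) (join-on y M) yL

  concurrent⇒typeB : ∀ {p N} → p ∈ Points 𝒢 → N ∈ Lines 𝒢 →
    (∀ {L} → L ∈ Lines 𝒢 → p I L) → IsTypeB Δ 𝒢
  concurrent⇒typeB {p} {N} p∈ N∈ concurrent =
    p , (λ q → mk⇔ perp λ { (inj₁ refl) → p∈
                          ; (inj₂ (L , qL , pL)) → full (pencil pL) qL })
      , (λ L → mk⇔ concurrent pencil)
    where
    perp : ∀ {q} → q ∈ Points 𝒢 → q ∈ p ^⊥
    perp {q} q∈ with q I? N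
    ... | yes qN = inj₂ (N , qN , concurrent N∈)
    ... | no q∉N = inj₂ (join q N , join-on q N , concurrent (join∈ q∈ N∈ q∉N))

    -- A point g of 𝒢 on a second line V through z ∈ U is collinear with p, and
    -- z, p, g would form a triangle.
    pencil : ∀ {U} → p I U → U ∈ Lines 𝒢
    pencil {U} pU = decidable-stable (lines? U) λ U∉ →
      let z , zU , z≢p , z∉ = outside-point U∉ p
          V , zV , V≢U      = second-line z U
          g , gV , g∈       = meets V
          z≢g eq     = z∉ (subst (_∈ Points 𝒢) (sym eq) g∈)
          g∉U gU     = V≢U (line-unique z≢g zV gV zU gU)
      in [ (λ eq → g∉U (subst (_I U) (sym eq) pU))
         , (λ (W , gW , pW) → z≢p (foot-unique g∉U gV zV zU gW pW pU))
         ]′ (perp g∈)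

  -- Lines of a hyperplane that is not of type B

  module _ (¬typeB : ¬ IsTypeB Δ 𝒢) where

    line-avoiding : ∀ {p N} → p ∈ Points 𝒢 → N ∈ Lines 𝒢 →
                    ∃[ M ] M ∈ Lines 𝒢 × ¬ p I M
    line-avoiding {p} p∈ N∈ =
      decidable-stable (searchLine (λ M → lines? M ×-dec ¬? (p I? M))) λ none →
        ¬typeB (concurrent⇒typeB p∈ N∈ λ {L} L∈ →
          decidable-stable (p I? L) (λ p∉L → none (L , L∈ , p∉L)))

    -- Projecting `p` onto a line of `𝒢` that misses it gives a line of `𝒢` through `p`; the case
    -- analysis treats candidates for which this is `L` again.
    other-line : ∀ {p L} → L ∈ Lines 𝒢 → p I L →
                 ∃[ M ] M ∈ Lines 𝒢 × p I M × M ≢ L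
    other-line {p} {L} L∈ pL with line-avoiding (full L∈ pL) L∈
    ... | A , A∈ , p∉A with join p A ≟L L
    ... | no ≢L = join p A , join∈ (full L∈ pL) A∈ p∉A , join-on p A , ≢L
    -- Now `A` meets `L` in `foot p A`; `B` avoids that point, so `A` and `B` cannot meet `L` in the
    -- same point.
    ... | yes refl with line-avoiding (full A∈ (foot-on p A)) A∈
    ... | B , B∈ , a∉B with p I? B
    ... | yes pB = B , B∈ , pB , λ { refl → a∉B (foot-join p A) }
    ... | no p∉B with join p B ≟L join p A
    ... | no ≢L = join p B , join∈ (full L∈ pL) B∈ p∉B , join-on p B , ≢L
    ... | yes eq =
      join p T , join∈ (full L∈ pL) (join∈ (full A∈ rA) B∈ r∉B) p∉T , join-on p T , U≢L
      where
      -- L meets the disjoint lines A and B in points other than p; the line T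
      -- joining another point of A to B is disjoint from L.
      a = foot p A
      b = foot p B

      bL : b I L
      bL = subst (b I_) eq (foot-join p B)

      A≢L : A ≢ L
      A≢L eq = p∉A (subst (p I_) (sym eq) pL)

      disjoint : ∀ {e} → e I A → ¬ e I B
      disjoint {e} eA eB = a∉B (subst (_I B) (sym a≡b) (foot-on p B))
        where
        e∉L : ¬ e I L
        e∉L eL = A≢L (line-unique (λ eq → a∉B (subst (_I B) (sym eq) eB))
                        (foot-on p A) eA (foot-join p A) eL)
        a≡b : a ≡ b
        a≡b = foot-unique e∉L eA (foot-on p A) (foot-join p A) eB (foot-on p B) bL

      r   = proj₁ (second-point A a)
      rA  = proj₁ (proj₂ (second-point A a))
      r≢a = proj₂ (proj₂ (second-point A a))

      r∉L : ¬ r I L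
      r∉L rL = A≢L (line-unique r≢a rA (foot-on p A) rL (foot-join p A))

      r∉B : ¬ r I B
      r∉B = disjoint rA

      T = join r B

      T-disjoint : ∀ {f} → f I T → ¬ f I L
      T-disjoint fT fL = disjoint (subst (foot r B I_) T≡A (foot-join r B)) (foot-on r B)
        where
        T≡A : T ≡ A
        T≡A = join-unique r∉L (join-on r B) fT fL rA (foot-on p A) (foot-join p A)

      p∉T : ¬ p I T
      p∉T pT = T-disjoint pT pL

      U≢L : join p T ≢ L
      U≢L eq = T-disjoint (foot-on p T) (subst (foot p T I_) eq (foot-join p T))

-- Morphisms onto a subquadrangle all of whose lines are full lines of Δ′

module FullImage {Δ Δ′ : Geometry} (gq : IsFiniteThickGQ Δ) (gq′ : IsFiniteThickGQ Δ′)
                 (φ : Morphism Δ Δ′) where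
  open Geometry Δ using (_I_)
  open Geometry Δ′ using () renaming (_I_ to _I′_)
  open GQ gq
  module G′ = GQ gq′
  open Morphism φ renaming (onPoints to φP; onLines to φL)

  -- Together these make the image full in `Δ′`, with at least two of its lines through each of its
  -- points. In the application `second` carries the exclusion of type B.
  module _
    (cover  : ∀ L {p′} → p′ I′ φL L → ∃[ p ] φP p ≡ p′)
    (second : ∀ L {p′} → p′ I′ φL L → ∃[ M ] p′ I′ φL M × φL M ≢ φL L)
    where

    -- Incidences are preserved and projection in `Δ′` is unique, so the morphism commutes with
    -- projection as long as the images of `p` and `L` are not incident.
    φfoot-is : ∀ {p L q′ M′} → ¬ φP p I′ φL L →
               φP p I′ M′ → q′ I′ M′ → q′ I′ φL L → φP (foot p L) ≡ q′
    φfoot-is {p} {L} p′∉L′ = G′.foot-unique p′∉L′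
      (preservesI (join-on p L)) (preservesI (foot-join p L)) (preservesI (foot-on p L))

    φjoin-is : ∀ {p L q′ M′} → ¬ φP p I′ φL L →
               φP p I′ M′ → q′ I′ M′ → q′ I′ φL L → φL (join p L) ≡ M′
    φjoin-is {p} {L} p′∉L′ = G′.join-unique p′∉L′
      (preservesI (join-on p L)) (preservesI (foot-join p L)) (preservesI (foot-on p L))

    -- `cover` gives a preimage somewhere in `Δ`. To find one on `K`, a point `d` is taken above a
    -- second line through `p′` and projected onto `K`.
    lift : ∀ K {p′} → p′ I′ φL K → ∃[ p ] p I K × φP p ≡ p′
    lift K {p′} p′K with second K p′K
    ... | C , p′C , C≢K with G′.second-point (φL C) p′
    ... | d′ , d′C , d′≢p′ with cover C d′C
    ... | d , refl =
      foot d K , foot-on d K , φfoot-is d′∉K d′C p′C p′K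
      where
      d′∉K : ¬ φP d I′ φL K
      d′∉K d′K = C≢K (G′.line-unique d′≢p′ d′C p′C d′K p′K)

    -- τ₄ carries a line through v above φL K to lines through q, w, y and back to
    -- v.  It is onto, so K comes from a line M through y; M meets K in a point
    -- above x′, which differs from k although both are the foot of y on K.
    above-join : ∀ {v K} L {x′} → v I K → ¬ φP v I′ φL L →
                 x′ I′ φL K → x′ I′ φL L → K ≡ join v L
    above-join {v} {K} L {x′} vK v′∉L x′K x′L =
      decidable-stable (K ≟L join v L) impossible
      where
      impossible : K ≢ join v L → ⊥
      impossible K≢K₁
        -- Avoiding `φP v` keeps `k` apart from `v`; avoiding `x′` puts `φP k` off `φL L` and gives
        -- the final contradiction.
        with G′.third-point (φL K) x′ (φP v)
      ... | k′ , k′K , k′≢x′ , k′≢v′ with lift K k′K | G′.second-point (φL L) x′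
      ... | k , kK , refl | z′ , z′L , z′≢x′
        -- The point `y` will lie above `x′`, which is on `φL K`, so a direct join from `y` to a
        -- line above `φL K` has no controlled image. The detour by `q` and `w` runs above `φL K`,
        -- `φL L`, `φL R`, `φL L` and back to `φL K`.
        with G′.third-point (φL L) x′ z′ | second L z′L
      ... | q′ , q′L , q′≢x′ , q′≢z′ | R , z′R , R≢L
        with cover L q′L | G′.second-point (φL R) z′
      ... | q , refl | w′ , w′R , w′≢z′ with cover R w′R
      ... | w , refl = k′≢x′ (trans (cong φP (sym w₀≡k)) w₀′≡x′)
        where
        K₁ = join v L
        y  = foot k L

        L≢K : φL L ≢ φL K
        L≢K eq = v′∉L (subst (φP v I′_) (sym eq) (preservesI vK))

        k′∉L : ¬ φP k I′ φL L
        k′∉L k′L = L≢K (G′.line-unique k′≢x′ k′L x′L k′K x′K)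

        y′≡x′ : φP y ≡ x′
        y′≡x′ = φfoot-is k′∉L k′K x′K x′L

        q′∉K : ¬ φP q I′ φL K
        q′∉K q′K = L≢K (G′.line-unique q′≢x′ q′L x′L q′K x′K)

        q′∉R : ¬ φP q I′ φL R
        q′∉R q′R = R≢L (G′.line-unique q′≢z′ q′R z′R q′L z′L)

        w′∉L : ¬ φP w I′ φL L
        w′∉L w′L = R≢L (G′.line-unique w′≢z′ w′R z′R w′L z′L)

        y′∉R : ¬ φP y I′ φL R
        y′∉R y′R = R≢L (G′.line-unique z′≢x′ z′R x′R z′L x′L)
          where x′R = subst (_I′ φL R) y′≡x′ y′R

        v∉L : ¬ v I L
        v∉L vL = v′∉L (preservesI vL)

        -- Images cannot decide this, since `φP y` lies on `φL K`. Instead `K≢K₁` enters: a line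
        -- through `v` and `y` would be `K₁`, and `v`, `k`, `y` would form a triangle.
        y∉ : ∀ {N} → v I N → ¬ y I N
        y∉ {N} vN yN = contradiction y≡v (λ eq → v∉L (subst (_I L) eq (foot-on k L)))
          where
          N≡K₁ : N ≡ K₁
          N≡K₁ = sym (join-is v∉L vN yN (foot-on k L))
          k∉N : ¬ k I N
          k∉N kN = K≢K₁ (trans (line-unique (λ { refl → k′≢v′ refl }) kK vK kN vN) N≡K₁)
          y≡v : y ≡ v
          y≡v = foot-unique k∉N (join-on k L) (foot-join k L) yN kK vK vN

        Above : Line Δ → Set
        Above N = v I N × φL N ≡ φL K

        ∉-above : ∀ {a A B} → φL B ≡ φL A → ¬ φP a I′ φL A → ¬ a I B
        ∉-above {a} eq a′∉ aB = a′∉ (subst (φP a I′_) eq (preservesI aB))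

        persp : ∀ {r c′ B′ A N} → φL N ≡ φL A → ¬ φP r I′ φL A →
                φP r I′ B′ → c′ I′ B′ → c′ I′ φL A → φL (join r N) ≡ B′
        persp {r} {c′} eq r′∉ r′B c′B c′A =
          φjoin-is (λ r′N → r′∉ (subst (φP r I′_) eq r′N)) r′B c′B
            (subst (c′ I′_) (sym eq) c′A)

        τ₁ τ₂ τ₃ τ₄ : Line Δ → Line Δ
        τ₁ N = join q N
        τ₂ N = join w (τ₁ N)
        τ₃ N = join y (τ₂ N)
        τ₄ N = join v (τ₃ N)

        φτ₁ : ∀ {N} → Above N → φL (τ₁ N) ≡ φL L
        φτ₁ (_ , eq) = persp eq q′∉K q′L x′L x′K

        φτ₂ : ∀ {N} → Above N → φL (τ₂ N) ≡ φL R
        φτ₂ N↑ = persp (φτ₁ N↑) w′∉L w′R z′R z′L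

        φτ₃ : ∀ {N} → Above N → φL (τ₃ N) ≡ φL L
        φτ₃ N↑ = persp (φτ₂ N↑) y′∉R (preservesI (foot-on k L)) z′L z′R

        τ₄-above : ∀ {N} → Above N → Above (τ₄ N)
        τ₄-above N↑ = join-on v _ , persp (φτ₃ N↑) v′∉L (preservesI vK) x′K x′L

        τ₁⁻¹ : ∀ {N} → Above N → join v (τ₁ N) ≡ N
        τ₁⁻¹ N↑@(vN , _) = join-join vN (∉-above (φτ₁ N↑) v′∉L)

        τ₂⁻¹ : ∀ {N} → Above N → join q (τ₂ N) ≡ τ₁ N
        τ₂⁻¹ N↑ = join-join (join-on q _) (∉-above (φτ₂ N↑) q′∉R)

        τ₃⁻¹ : ∀ {N} → Above N → join w (τ₃ N) ≡ τ₂ N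
        τ₃⁻¹ N↑ = join-join (join-on w _) (∉-above (φτ₃ N↑) w′∉L)

        τ₄⁻¹ : ∀ {N} → Above N → join y (τ₄ N) ≡ τ₃ N
        τ₄⁻¹ N↑ = join-join (join-on y _) (y∉ (join-on v _))

        back : Line Δ → Line Δ
        back N = join v (join q (join w (join y N)))

        back∘τ₄ : ∀ {N} → Above N → back (τ₄ N) ≡ N
        back∘τ₄ N↑ rewrite τ₄⁻¹ N↑ | τ₃⁻¹ N↑ | τ₂⁻¹ N↑ = τ₁⁻¹ N↑

        τ₄-onto : ∃[ N ] Above N × τ₄ N ≡ K
        τ₄-onto = injective-on⇒surjective-on
          (λ N → (v I? N) ×-dec (φL N G′.≟L φL K)) τ₄ τ₄-above
          (λ N↑ P↑ eq → trans (sym (back∘τ₄ N↑)) (trans (cong back eq) (back∘τ₄ P↑)))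
          (vK , refl)

        M  = τ₃ (proj₁ τ₄-onto)
        w₀ = foot v M

        M↑ : φL M ≡ φL L
        M↑ = φτ₃ (proj₁ (proj₂ τ₄-onto))

        w₀K : w₀ I K
        w₀K = subst (w₀ I_) (proj₂ (proj₂ τ₄-onto)) (foot-join v M)

        w₀′≡x′ : φP w₀ ≡ x′
        w₀′≡x′ = decidable-stable (_ G′.≟P _) λ w₀′≢x′ →
          L≢K (G′.line-unique w₀′≢x′
                 (subst (φP w₀ I′_) M↑ (preservesI (foot-on v M))) x′L (preservesI w₀K) x′K)

        w₀≡k : w₀ ≡ k
        w₀≡k = foot-unique (y∉ vK) (join-on y _) (foot-on v M) w₀K
                 (foot-join k L) (join-on k L) kK

    -- Both lines equal `join v L`, where `φL L` meets their common image in a point other than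
    -- `φP v`.
    line-above-unique : ∀ {v K N} → v I K → v I N → φL K ≡ φL N → K ≡ N
    line-above-unique {v} {K} {N} vK vN eq
      with G′.second-point (φL K) (φP v)
    ... | x′ , x′K , x′≢v′ with second K x′K
    ... | L , x′L , L≢K =
      trans (above-join L vK v′∉L x′K x′L)
            (sym (above-join L vN v′∉L (subst (x′ I′_) eq x′K) x′L))
      where
      v′∉L : ¬ φP v I′ φL L
      v′∉L v′L = L≢K (G′.line-unique x′≢v′ x′L v′L x′K (preservesI vK))

    -- If `x` and `w` differ, take lines `K` through `w` and `M` through `x`, both other than `N`,
    -- with different images. Joining a point `y` of `K` to `M` gives a line above `φL K`, hence `K`
    -- itself; so `K` meets `M` and closes a triangle with `N`.
    injective-on-line : ∀ {x w N} → x I N → w I N → φP x ≡ φP w → x ≡ w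
    injective-on-line {x} {w} {N} xN wN x′≡w′ = decidable-stable (x ≟P w) impossible
      where
      impossible : x ≢ w → ⊥
      impossible x≢w with second-line w N
      ... | K , wK , K≢N with transversal
        where
        transversal : ∃[ M ] x I M × M ≢ N × φL M ≢ φL K
        transversal with second-line x N
        ... | A , xA , A≢N with third-line x N A
        ... | B , xB , B≢N , B≢A with φL A G′.≟L φL K
        ... | no A′≢K′  = A , xA , A≢N , A′≢K′
        -- Only one line through `x` can lie above `φL K`, and `A` is that line.
        ... | yes A′≡K′ = B , xB , B≢N , λ B′≡K′ →
          B≢A (line-above-unique xB xA (trans B′≡K′ (sym A′≡K′)))
      ... | M , xM , M≢N , M′≢K′ with G′.second-point (φL K) (φP x)
      ... | y′ , y′K , y′≢x′ with lift K y′K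
      ... | y , yK , refl =
        M≢N (sym (join-unique x∉K xN wN wK xM (foot-on y M) fK))
        where
        x′K : φP x I′ φL K
        x′K = subst (_I′ φL K) (sym x′≡w′) (preservesI wK)

        y′∉M : ¬ φP y I′ φL M
        y′∉M y′M = M′≢K′ (G′.line-unique y′≢x′ y′M (preservesI xM) y′K x′K)

        J≡K : join y M ≡ K
        J≡K = line-above-unique (join-on y M) yK (φjoin-is y′∉M y′K x′K (preservesI xM))

        fK : foot y M I K
        fK = subst (foot y M I_) J≡K (foot-join y M)

        x∉K : ¬ x I K
        x∉K xK = K≢N (line-unique x≢w xK wK xN wN)

    -- Let `f` be the foot of `w` on a line `L` through `x`. If `f` and `x` have the same image they
    -- coincide; otherwise `L` and `join w L` have the same image and share `f`, so they coincide.
    -- Either way `x` and `w` are collinear.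
    injective : ∀ {x w} → φP x ≡ φP w → x ≡ w
    injective {x} {w} x′≡w′ with line-through x
    ... | L , xL with φP (foot w L) G′.≟P φP x
    ... | yes f′≡x′ = injective-on-line
      (subst (_I join w L) (injective-on-line (foot-on w L) xL f′≡x′) (foot-join w L))
      (join-on w L) x′≡w′
    ... | no f′≢x′ = injective-on-line xL (subst (w I_) J≡L (join-on w L)) x′≡w′
      where
      J≡L : join w L ≡ L
      J≡L = line-above-unique (foot-join w L) (foot-on w L)
        (G′.line-unique f′≢x′
          (preservesI (foot-join w L))
          (subst (_I′ φL (join w L)) (sym x′≡w′) (preservesI (join-on w L)))
          (preservesI (foot-on w L)) (preservesI xL))

-- Morphisms mapping one hyperplane onto another

module _ {Δ Δ′ : Geometry} (gq : IsFiniteThickGQ Δ) (gq′ : IsFiniteThickGQ Δ′)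
         (φ : Morphism Δ Δ′) {𝒢 : Subgeometry Δ} {𝒢′ : Subgeometry Δ′}
         (isH : IsHyperplane Δ 𝒢) (isH′ : IsHyperplane Δ′ 𝒢′)
         (image : ImageIs φ 𝒢 𝒢′) where
  open Geometry Δ using (_I_)
  open Geometry Δ′ using () renaming (_I_ to _I′_)
  open GQ gq
  private
    module G′ = GQ gq′
    module H′ = Hyperplane gq′ isH′
  open Morphism φ renaming (onPoints to φP; onLines to φL)

  hyperplane-point : ∀ {p′} → p′ ∈ Points 𝒢′ → ∃[ p ] p ∈ Points 𝒢 × φP p ≡ p′
  hyperplane-point {p′} = Equivalence.to (proj₁ image p′)

  hyperplane-line : ∀ {L′} → L′ ∈ Lines 𝒢′ → ∃[ L ] L ∈ Lines 𝒢 × φL L ≡ L′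
  hyperplane-line {L′} = Equivalence.to (proj₂ image L′)

  not-onto-hyperplane : ¬ IsTypeB Δ′ 𝒢′ → ¬ (∀ L → φL L ∈ Lines 𝒢′)
  not-onto-hyperplane ¬typeB all∈ =
    let p , p∉       = IsHyperplane.proper isH
        L , pL       = line-through p
        w , w∈ , w′≡ = hyperplane-point (H′.full (all∈ L) (preservesI pL))
    in p∉ (subst (_∈ Points 𝒢) (FullImage.injective gq gq′ φ cover second w′≡) w∈)
    where
    cover : ∀ L {p′} → p′ I′ φL L → ∃[ p ] φP p ≡ p′
    cover L p′L = let p , _ , eq = hyperplane-point (H′.full (all∈ L) p′L) in p , eq

    second : ∀ L {p′} → p′ I′ φL L → ∃[ M ] p′ I′ φL M × φL M ≢ φL L
    second L p′L with H′.other-line ¬typeB (all∈ L) p′L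
    ... | M′ , M′∈ , p′M′ , M′≢ with hyperplane-line M′∈
    ... | M , _ , refl = M , p′M′ , M′≢

  -- The lines through `y′` are included so that the property can propagate along each of them.
  Hit : Pred (Point Δ′) 0ℓ
  Hit y′ = (∃[ y ] φP y ≡ y′) × (∀ {M′} → y′ I′ M′ → ∃[ M ] φL M ≡ M′)

  -- Another line `M′` through `y′` contains some `φP g` with `g` in `𝒢`; projecting `g` onto `L`
  -- yields preimages of `y′` and of `M′` at once.
  hit-on : ∀ L {y′} → y′ I′ φL L → y′ ∉ Points 𝒢′ → Hit y′
  hit-on L {y′} y′L y′∉ = point , line
    where
    hit-via : ∀ {M′} → y′ I′ M′ → M′ ≢ φL L →
              (∃[ y ] φP y ≡ y′) × (∃[ M ] φL M ≡ M′)
    hit-via {M′} y′M′ M′≢L with H′.meets M′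
    ... | g′ , g′M′ , g′∈ with hyperplane-point g′∈
    ... | g , _ , refl =
      (foot g L , G′.foot-unique g′∉L (preservesI (join-on g L)) (preservesI (foot-join g L))
                    (preservesI (foot-on g L)) g′M′ y′M′ y′L) ,
      (join g L , G′.join-unique g′∉L (preservesI (join-on g L)) (preservesI (foot-join g L))
                    (preservesI (foot-on g L)) g′M′ y′M′ y′L)
      where
      g′∉L : ¬ φP g I′ φL L
      g′∉L g′L = M′≢L (G′.line-unique (λ { refl → y′∉ g′∈ }) y′M′ g′M′ y′L g′L)

    point : ∃[ y ] φP y ≡ y′
    point = let _ , on , ≢L = G′.second-line y′ (φL L) in proj₁ (hit-via on ≢L)

    line : ∀ {M′} → y′ I′ M′ → ∃[ M ] φL M ≡ M′
    line {M′} y′M′ with M′ G′.≟L φL L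
    ... | yes eq = L , sym eq
    ... | no ≢L  = proj₂ (hit-via y′M′ ≢L)

  hit-outside : ∀ L → φL L ∉ Lines 𝒢′ → ∀ {y′} → y′ ∉ Points 𝒢′ → Hit y′
  hit-outside L L′∉ y′∉ =
    -- The point to be avoided is arbitrary here; the one from `proper` serves as a default.
    let x′ , x′L , _ , x′∉ = H′.outside-point L′∉ (proj₁ (IsHyperplane.proper isH′))
    in H′.outside-connected Hit step x′∉ y′∉ (hit-on L x′L x′∉)
    where
    step : ∀ {x′ y′ L′} → x′ I′ L′ → y′ I′ L′ → x′ ∉ Points 𝒢′ → y′ ∉ Points 𝒢′ →
           Hit x′ → Hit y′
    step x′L′ y′L′ _ y′∉ (_ , lines) with lines x′L′
    ... | M , refl = hit-on M y′L′ y′∉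

  surjective : ∀ L → φL L ∉ Lines 𝒢′ → IsSurjective φ
  surjective L L′∉ = (λ p′ → let p , eq = point p′ in p , λ { refl → eq })
                   , (λ M′ → let M , eq = line M′ in M , λ { refl → eq })
    where
    open Subgeometry 𝒢′ using (points?; lines?)

    point : ∀ p′ → ∃[ p ] φP p ≡ p′
    point p′ with points? p′
    ... | yes p′∈ = let p , _ , eq = hyperplane-point p′∈ in p , eq
    ... | no p′∉  = proj₁ (hit-outside L L′∉ p′∉)

    line : ∀ M′ → ∃[ M ] φL M ≡ M′
    line M′ with lines? M′
    ... | yes M′∈ = let M , _ , eq = hyperplane-line M′∈ in M , eq
    ... | no M′∉  =
      let _ , on , _ , x′∉ = H′.outside-point M′∉ (proj₁ (IsHyperplane.proper isH′))
      in proj₂ (hit-outside L L′∉ x′∉) on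

mainTheorem7 : (Δ Δ′ : Geometry) → IsFiniteThickGQ Δ → IsFiniteThickGQ Δ′ →
    (φ : Morphism Δ Δ′) →
    (𝒢 : Subgeometry Δ) (𝒢′ : Subgeometry Δ′) →
    IsHyperplane Δ 𝒢 → IsHyperplane Δ′ 𝒢′ →
    ImageIs φ 𝒢 𝒢′ →
    ¬ IsTypeB Δ′ 𝒢′ →
    IsSurjective φ
mainTheorem7 Δ Δ′ gq gq′ φ 𝒢 𝒢′ isH isH′ image ¬typeB
  with GQ.searchLine gq (λ L → ¬? (Subgeometry.lines? 𝒢′ (Morphism.onLines φ L)))
... | yes (L , L′∉) = surjective gq gq′ φ isH isH′ image L L′∉
... | no none = contradiction
  (λ L → decidable-stable (Subgeometry.lines? 𝒢′ _) (λ L′∉ → none (L , L′∉)))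
  (not-onto-hyperplane gq gq′ φ isH isH′ image ¬typeB)
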